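{- Let $a\ge 2$, $c>0$, $d$ be integers with $d<ca$ and $\gcd(d,a)=\gcd(d,c)=1$, let $n\ge 1$, and let $\mathbf s_j=ca^{n+j}-d$ for $j\in\mathbb N$ and $S_n=\langle\{\mathbf s_j:j\in\mathbb N\}\rangle$. Assume $d>0$. Let $m=e(S_n)$, assume $m\ge2$, let $\lambda=\gcd(S_n)$, and let $(\alpha_1,\ldots,\alpha_{m-1})$ be the unique residual $(m-1)$-tuple such that $\mathbf s_0/\lambda=1+\sum_{j=1}^{m-1}\alpha_j\mathbf R_j$ (such a tuple exists and is unique). Then $$\max\mathrm{Ap}(S_n,\mathbf s_0)=\sum_{j=1}^{m-1}\alpha_j\mathbf s_j.$$ Moreover, for the numerical semigroup $(1/\lambda)S_n$ we have $$\mathrm F((1/\lambda)S_n)=\sum_{j=1}^{m-1}\alpha_j(\mathbf s_j/\lambda)-\mathbf s_0/\lambda.$$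
   Context: $\mathbb N=\{0,1,2,\ldots\}$. For $A\subseteq\mathbb N$, $\langle A\rangle$ is the submonoid of $(\mathbb N,+)$ generated by $A$. For a nontrivial submonoid $M$ of $\mathbb N$, the minimal generating set of $M$ is the unique generating set contained in every generating set of $M$ (its elements are the nonzero elements of $M$ that are not sums of two nonzero elements of $M$; it is finite), and $e(M)$ is its cardinality. $\gcd(M)$ denotes the greatest common divisor of all elements of $M$, and with $\lambda=\gcd(M)$, $(1/\lambda)M=\{x/\lambda:x\in M\}$, which is a numerical semigroup (a submonoid of $\mathbb N$ with finite complement). For a numerical semigroup $S$, the Frobenius number $\mathrm F(S)$ is the largest element of $\mathbb N\setminus S$. For $x\in M\setminus\{0\}$, the Apéry set is $\mathrm{Ap}(M,x)=\{y\in M: y-x\notin M\}$. The repunit numbers in base $a$ are $\mathbf R_0=0$ and $\mathbf R_k=1+a+\cdots+a^{k-1}$ for $k\ge1$. For $r\ge 1$, a residual $r$-tuple (with respect to $a$) is a tuple of integers $(\alpha_1,\ldots,\alpha_r)$ such that (1) $0\le\alpha_i\le a$ for all $i$, and (2) if $\alpha_{i_0}=a$ for some $i_0\in\{2,\ldots,r\}$ then $\alpha_i=0$ for all $i\in\{1,\ldots,i_0-1\}$. -}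

module Defs where

open import Level using (0ℓ)
open import Data.Nat.Base
open import Data.Nat.DivMod using (_/_)
open import Data.Nat.Divisibility using (_∣_)
open import Data.Nat.Properties using (+-*-semiring)
import Data.Integer.Base as ℤ
open import Data.Fin.Base as Fin using (Fin; toℕ)
open import Data.List.Base using (List; length)
open import Data.List.Membership.Propositional using () renaming (_∈_ to _∈ˡ_)
open import Data.List.Relation.Unary.Unique.Propositional using (Unique)
open import Data.Product.Base using (_×_; ∃-syntax)
open import Data.Vec.Functional using (Vector)
open import Relation.Nullary.Negation.Core using (¬_)
open import Relation.Unary using (Pred; _∈_; _⊆_; _≐_; ∁)
open import Relation.Binary.PropositionalEquality.Core using (_≡_)
open import Algebra.Properties.Semiring.Sum +-*-semiring public
  using (sum; sum-syntax)

data ⟨_⟩ (A : Pred ℕ 0ℓ) : Pred ℕ 0ℓ where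
  gen   : ∀ {x} → x ∈ A → x ∈ ⟨ A ⟩
  ε     : 0 ∈ ⟨ A ⟩
  _⊕_   : ∀ {x y} → x ∈ ⟨ A ⟩ → y ∈ ⟨ A ⟩ → x + y ∈ ⟨ A ⟩

Generates : Pred ℕ 0ℓ → Pred ℕ 0ℓ → Set
Generates A M = ⟨ A ⟩ ≐ M

IsMinimalGeneratingSet : Pred ℕ 0ℓ → Pred ℕ 0ℓ → Set₁
IsMinimalGeneratingSet A M =
  Generates A M × (∀ (B : Pred ℕ 0ℓ) → Generates B M → A ⊆ B)

-- e(M) ≡ m, the minimal generating set being enumerated without repetition
-- by a list of length m.
HasEmbeddingDimension : Pred ℕ 0ℓ → ℕ → Set₁
HasEmbeddingDimension M m =
  ∃[ xs ] (Unique xs × length xs ≡ m × IsMinimalGeneratingSet (_∈ˡ xs) M)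

-- Same shape as the library's Data.Nat.GCD.GCD: greatest with respect to
-- divisibility.
record IsGCD (M : Pred ℕ 0ℓ) (g : ℕ) : Set where
  field
    commonDivisor : ∀ {x} → x ∈ M → g ∣ x
    greatest      : ∀ {k} → (∀ {x} → x ∈ M → k ∣ x) → k ∣ g

-- (1/g)M = { x/g : x ∈ M }. It is only meant for g dividing every element of
-- M, in which case the floor division is exact.
[1/_]_ : (g : ℕ) .{{_ : NonZero g}} → Pred ℕ 0ℓ → Pred ℕ 0ℓ
([1/ g ] M) y = ∃[ x ] (x ∈ M × y ≡ x / g)

IsMaximum : Pred ℕ 0ℓ → ℕ → Set
IsMaximum P x = x ∈ P × (∀ {y} → y ∈ P → y ≤ x)

IsFrobeniusNumber : Pred ℕ 0ℓ → ℕ → Set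
IsFrobeniusNumber S = IsMaximum (∁ S)

-- y ⊖ x is the integer y - x, so that "y - x ∉ M" also covers y < x.
Ap : Pred ℕ 0ℓ → ℕ → Pred ℕ 0ℓ
Ap M x y = y ∈ M × ¬ (∃[ z ] (z ∈ M × ℤ.+ z ≡ y ℤ.⊖ x))

-- The repunit number R_k in base a; the empty sum gives R_0 = 0.
R : ℕ → ℕ → ℕ
R a k = ∑[ i < k ] (a ^ toℕ i)

-- The entry of α at i : Fin r is the paper's α_{toℕ i + 1}. The restriction
-- i₀ ≥ 2 (in 1-based indices) is implied by i < i₀.
record IsResidual (a r : ℕ) (α : Vector ℕ r) : Set where
  field
    bounded : ∀ i → α i ≤ a
    initial : ∀ i₀ → α i₀ ≡ a → ∀ i → i Fin.< i₀ → α i ≡ 0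

-- s_j = c a^(n+j) - d. The subtraction is never truncated when d < c a and
-- n ≥ 1 (and a ≥ 1).
s : (a c d n j : ℕ) → ℕ
s a c d n j = c * a ^ (n + j) ∸ d

S : (a c d n : ℕ) → Pred ℕ 0ℓ
S a c d n = ⟨ (λ x → ∃[ j ] x ≡ s a c d n j) ⟩

-- α is the residual (m-1)-tuple with s_0/g = 1 + Σ_{j=1}^{m-1} α_j R_j.
IsResidualExpansion : (a c d n m g : ℕ) .{{_ : NonZero g}} → Vector ℕ (m ∸ 1) → Set
IsResidualExpansion a c d n m g α =
  IsResidual a (m ∸ 1) α ×
  s a c d n 0 / g ≡ 1 + ∑[ j < m ∸ 1 ] (α j * R a (suc (toℕ j)))

{-# OPTIONS --safe #-}

-- Write s_j = s_0 + (a-1) c aⁿ R_j and divide by λ: with N = s_0/λ and K =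
-- (a-1) c aⁿ/λ, the element obtained by summing ℓ generators whose repunits add
-- up to w is N ℓ + K w, and N and K are coprime, so that its class modulo N is
-- determined by w modulo N. The smallest element of a class has w < N (as K >
-- N, a larger w never pays) and ℓ the least number of repunits with sum w.
-- Since R_{i+1} = 1 + a R_i, passing from w to w - 1 raises that number by at
-- most a - 1; as (a-1) N ≤ K, these smallest elements increase with w. The
-- largest one is that of w = N - 1, where the residual tuple is an optimal
-- representation. Finally s_0, ..., s_j are irreducible as soon as R_j < N,
-- hence N ≤ R_m and m - 1 digits suffice.

module Submission where

open import Defs
open import Level using (0ℓ)
open import Data.Nat.Base hiding (_/_; _%_)
open import Data.Nat.Coprimality using (Coprime; coprime-divisor; coprime-Bézout)
open import Data.Nat.Divisibility
open import Data.Nat.DivMod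
open import Data.Nat.GCD using (gcd; module Bézout)
open import Data.Nat.Properties
open import Data.Nat.Tactic.RingSolver using (solve-∀)
open import Algebra.Properties.Semiring.Sum +-*-semiring
  using (sum-cong-≗; sum-init-last; sum-replicate-zero; *-distribˡ-sum; *-distribʳ-sum)
open import Data.Integer.Base using (+_; _⊖_)
open import Data.Integer.Properties using (⊖-≥; +-injective)
open import Data.Fin.Base as Fin using (Fin; zero; suc; toℕ; fromℕ; inject₁)
open import Data.Fin.Properties
  using (pigeonhole; toℕ-inject₁; toℕ-fromℕ; toℕ<n; toℕ≤pred[n])
open import Data.Fin.Relation.Unary.Top using (view; ‵fromℕ; ‵inj₁)
open import Data.List.Base as List using (List; length; lookup)
open import Data.List.Membership.Propositional using () renaming (_∈_ to _∈ˡ_)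
open import Data.List.Relation.Unary.All using (_∷_)
open import Data.List.Relation.Unary.AllPairs using (_∷_)
open import Data.List.Relation.Unary.Any using (here; there; index)
open import Data.List.Relation.Unary.Any.Properties using (lookup-index)
open import Data.List.Relation.Unary.Unique.Propositional using (Unique)
open import Data.Product using (_×_; _,_; ∃₂; ∃-syntax; ∃!)
open import Data.Sum using (_⊎_; inj₁; inj₂)
open import Data.Unit using (tt)
open import Data.Vec.Functional using (Vector; init; last; insertAt)
open import Data.Vec.Functional.Properties using (insertAt-lookup)
open import Function using (_∘_; case_of_)
open import Relation.Nullary using (¬_; contradiction; yes; no)
open import Relation.Unary using (Pred; _∈_; _∉_; _⊆_; U)
open import Relation.Binary.PropositionalEquality

-- Repunit numbers

R-suc : ∀ a k → R a (suc k) ≡ 1 + a * R a k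
R-suc a k = cong suc (sym (*-distribˡ-sum a (λ (i : Fin k) → a ^ toℕ i)))

R-mono-≤ : ∀ b {i j} → i ≤ j → R (suc b) i ≤ R (suc b) j
R-mono-≤ b z≤n = z≤n
R-mono-≤ b {suc i} {suc j} (s≤s i≤j) = begin
  R (suc b) (suc i)        ≡⟨ R-suc (suc b) i ⟩
  1 + suc b * R (suc b) i  ≤⟨ s≤s (*-monoʳ-≤ (suc b) (R-mono-≤ b i≤j)) ⟩
  1 + suc b * R (suc b) j  ≡⟨ R-suc (suc b) j ⟨
  R (suc b) (suc j)        ∎
  where open ≤-Reasoning

R-reflects-< : ∀ b {i j} → R (suc b) i < R (suc b) j → i < j
R-reflects-< b Ri<Rj = ≰⇒> (λ j≤i → <⇒≱ Ri<Rj (R-mono-≤ b j≤i))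

-- The geometric sum `(a - 1) R_j = a^j - 1` for `a = suc b`, free of subtraction; it makes every
-- generator affine in a repunit.
^≡1+R : ∀ b j → suc b ^ j ≡ 1 + b * R (suc b) j
^≡1+R b zero    = cong suc (sym (*-zeroʳ b))
^≡1+R b (suc j) = begin
  suc b * suc b ^ j                  ≡⟨ cong (suc b *_) (^≡1+R b j) ⟩
  suc b * (1 + b * R (suc b) j)      ≡⟨ lemma b (R (suc b) j) ⟩
  1 + b * (1 + suc b * R (suc b) j)  ≡⟨ cong (λ x → 1 + b * x) (R-suc (suc b) j) ⟨
  1 + b * R (suc b) (suc j)          ∎
  where
  open ≡-Reasoning
  lemma : ∀ b x → suc b * (1 + b * x) ≡ 1 + b * (1 + suc b * x)
  lemma = solve-∀

R-mono-< : ∀ b {i j} → i < j → R (suc b) i < R (suc b) j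
R-mono-< b {i} {j} i<j = begin-strict
  R (suc b) i              <⟨ s≤s (m≤m+n _ _) ⟩
  1 + suc b * R (suc b) i  ≡⟨ R-suc (suc b) i ⟨
  R (suc b) (suc i)        ≤⟨ R-mono-≤ b i<j ⟩
  R (suc b) j              ∎
  where open ≤-Reasoning

-- Sums of repunits

-- Index 0 is allowed and R a 0 ≡ 0, so in `Rep a P ℓ w` the number ℓ is only
-- an upper bound for the number of nonzero summands once 0 ∈ P.
data Rep (a : ℕ) (P : Pred ℕ 0ℓ) : ℕ → ℕ → Set where
  []   : Rep a P 0 0
  _∷_  : ∀ {j ℓ w} → j ∈ P → Rep a P ℓ w → Rep a P (suc ℓ) (R a j + w)

module _ {a : ℕ} where

  Rep-⊆ : ∀ {P Q ℓ w} → P ⊆ Q → Rep a P ℓ w → Rep a Q ℓ w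
  Rep-⊆ P⊆Q []       = []
  Rep-⊆ P⊆Q (p ∷ ρ)  = P⊆Q p ∷ Rep-⊆ P⊆Q ρ

  Rep-+ : ∀ {P ℓ ℓ′ w w′} → Rep a P ℓ w → Rep a P ℓ′ w′ → Rep a P (ℓ + ℓ′) (w + w′)
  Rep-+ []                     σ = σ
  Rep-+ (_∷_ {j} {w = w} p ρ)  σ = subst (Rep a _ _) (sym (+-assoc (R a j) w _)) (p ∷ Rep-+ ρ σ)

  Rep-replicate : ∀ {P j} k → j ∈ P → Rep a P k (k * R a j)
  Rep-replicate zero    p = []
  Rep-replicate (suc k) p = p ∷ Rep-replicate k p

  -- A summand `R_0 = 0` lengthens a representation and keeps its weight; in `T` each one adds the
  -- generator `N`.
  Rep-pad : ∀ {P ℓ w} k → 0 ∈ P → Rep a P ℓ w → Rep a P (k + ℓ) w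
  Rep-pad zero    0∈P ρ = ρ
  Rep-pad (suc k) 0∈P ρ = 0∈P ∷ Rep-pad k 0∈P ρ

  -- Case distinction for the exchange argument in `Rep-remove`: a summand of top index is brought
  -- to the front, and if there is none the bound on the indices drops.
  Rep-split : ∀ {r ℓ w} → Rep a (_≤ suc r) ℓ w →
    (∃₂ λ ℓ′ w′ → ℓ ≡ suc ℓ′ × w ≡ R a (suc r) + w′ × Rep a (_≤ suc r) ℓ′ w′) ⊎
    Rep a (_≤ r) ℓ w
  Rep-split [] = inj₂ []
  Rep-split {r} (_∷_ {j} {w = w} j≤1+r ρ) with m≤n⇒m<n∨m≡n j≤1+r
  ... | inj₂ refl       = inj₁ (_ , _ , refl , refl , ρ)
  ... | inj₁ (s≤s j≤r)  with Rep-split ρ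
  ...   | inj₂ σ = inj₂ (j≤r ∷ σ)
  ...   | inj₁ (ℓ′ , w′ , refl , refl , σ) =
          inj₁ (_ , _ , refl , lemma (R a j) (R a (suc r)) w′ , (j≤1+r ∷ σ))
    where
    lemma : ∀ x y z → x + (y + z) ≡ y + (x + z)
    lemma = solve-∀

module _ {b : ℕ} where

  private a = suc b

  -- No summand exceeds the total, and repunits increase with their index.
  Rep-restrict : ∀ {P r ℓ w} → w < R a (suc r) → Rep a P ℓ w → Rep a (_≤ r) ℓ w
  Rep-restrict w<R []                     = []
  Rep-restrict {r = r} w<R (_∷_ {j} {w = w} _ ρ)  =
    s≤s⁻¹ (R-reflects-< b {j} {suc r} (≤-<-trans (m≤m+n (R a j) w) w<R)) ∷
    Rep-restrict (≤-<-trans (m≤n+m w (R a j)) w<R) ρ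

  -- Replace one summand R (i + 1) = 1 + a R i by a copies of R i.
  Rep-decrement : ∀ {r ℓ v} → Rep a (_≤ r) ℓ (suc v) → Rep a (_≤ r) (b + ℓ) v
  Rep-decrement {r} {ℓ} {v} ρ = go ρ refl
    where
    go : ∀ {ℓ w} → Rep a (_≤ r) ℓ w → ∀ {v} → w ≡ suc v → Rep a (_≤ r) (b + ℓ) v
    -- A summand `R_0` cannot be lowered, so it is kept and the search goes on; a positive index
    -- must follow because the weight is positive.
    go (_∷_ {zero} {ℓ} p ρ) {v} eq =
      subst (λ k → Rep a (_≤ r) k v) (sym (+-suc b ℓ)) (_∷_ {j = 0} p (go ρ eq))
    go (_∷_ {suc i} {ℓ} {w} p ρ) {v} eq =
      subst₂ (Rep a _) (sym (+-suc b ℓ))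
        (suc-injective (trans (cong (_+ w) (sym (R-suc a i))) eq))
        (Rep-+ (Rep-replicate a (≤-trans (n≤1+n i) p)) ρ)

  Rep-decrement-* : ∀ {r ℓ v} k → Rep a (_≤ r) ℓ (k + v) → Rep a (_≤ r) (k * b + ℓ) v
  Rep-decrement-* zero ρ = ρ
  Rep-decrement-* {r} {ℓ} {v} (suc k) ρ =
    subst (λ x → Rep a (_≤ r) x v) (lemma (k * b) b ℓ) (Rep-decrement-* k (Rep-decrement ρ))
    where
    lemma : ∀ x y z → x + (y + z) ≡ y + x + z
    lemma = solve-∀

  -- If R (r + 1) itself is not a summand, remove R r a times and decrement once.
  mutual
    Rep-remove : ∀ r {ℓ v} → Rep a (_≤ suc r) ℓ (R a (suc r) + v) →
      ∃[ ℓ′ ] (ℓ ≡ suc ℓ′ × Rep a (_≤ suc r) ℓ′ v)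
    Rep-remove r {ℓ} {v} ρ with Rep-split ρ
    ... | inj₁ (ℓ′ , w′ , refl , eq , σ) =
          ℓ′ , refl , subst (Rep a _ ℓ′) (+-cancelˡ-≡ (R a (suc r)) w′ v (sym eq)) σ
    -- Only summands `R_0` are left, yet the weight is at least `R_1 = 1`.
    Rep-remove zero ρ | inj₂ σ = contradiction (go σ) (λ ())
      where
      go : ∀ {ℓ w} → Rep a (_≤ 0) ℓ w → w ≡ 0
      go [] = refl
      go (z≤n ∷ σ) = go σ
    -- The weight equals `a * R a (suc r) + suc v`. Removing `a` summands and then decrementing,
    -- which adds `b = a - 1`, saves exactly one summand.
    Rep-remove (suc r) {ℓ} {v} ρ | inj₂ σ
      with ℓ′ , refl , τ ← Rep-remove-* r a (subst (Rep a _ ℓ)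
             (trans (cong (_+ v) (R-suc a (suc r))) (sym (+-suc (a * R a (suc r)) v))) σ)
      = b + ℓ′ , refl , Rep-⊆ m≤n⇒m≤1+n (Rep-decrement τ)

    Rep-remove-* : ∀ r k {ℓ v} → Rep a (_≤ suc r) ℓ (k * R a (suc r) + v) →
      ∃[ ℓ′ ] (ℓ ≡ k + ℓ′ × Rep a (_≤ suc r) ℓ′ v)
    Rep-remove-* r zero    ρ = _ , refl , ρ
    Rep-remove-* r (suc k) {ℓ} {v} ρ
      with ℓ₁ , refl , σ ← Rep-remove r (subst (Rep a _ ℓ) (+-assoc (R a (suc r)) (k * R a (suc r)) v) ρ)
      with ℓ₂ , refl , τ ← Rep-remove-* r k σ = ℓ₂ , refl , τ

-- Residual tuples

value : (a : ℕ) {r : ℕ} → Vector ℕ r → ℕ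
value a {r} α = ∑[ j < r ] (α j * R a (suc (toℕ j)))

value-init-last : ∀ a {r} (α : Vector ℕ (suc r)) →
  value a α ≡ value a (init α) + last α * R a (suc r)
value-init-last a {r} α = trans
  (sum-init-last (λ j → α j * R a (suc (toℕ j))))
  (cong₂ _+_
    (sum-cong-≗ (λ j → cong (λ k → α (inject₁ j) * R a (suc k)) (toℕ-inject₁ j)))
    (cong (λ k → last α * R a (suc k)) (toℕ-fromℕ r)))

lookup≤sum : ∀ {r} (α : Vector ℕ r) i → α i ≤ sum α
lookup≤sum α zero    = m≤m+n (α zero) _
lookup≤sum α (suc i) = ≤-trans (lookup≤sum (α ∘ suc) i) (m≤n+m _ (α zero))

sum-mono-≤ : ∀ {r} (α β : Vector ℕ r) → (∀ i → α i ≤ β i) → sum α ≤ sum β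
sum-mono-≤ {zero}  α β α≤β = z≤n
sum-mono-≤ {suc r} α β α≤β = +-mono-≤ (α≤β zero) (sum-mono-≤ (α ∘ suc) (β ∘ suc) (α≤β ∘ suc))

sum≤value : ∀ a {r} (α : Vector ℕ r) → sum α ≤ value a α
sum≤value a α = sum-mono-≤ α _ (λ j → m≤m*n (α j) (R a (suc (toℕ j))))

value-zero : ∀ a {r} (α : Vector ℕ r) → (∀ i → α i ≡ 0) → value a α ≡ 0
value-zero a {r} α α≡0 = trans
  (sum-cong-≗ (λ j → cong (_* R a (suc (toℕ j))) (α≡0 j)))
  (sum-replicate-zero r)

residual-init : ∀ {a r} {α : Vector ℕ (suc r)} → IsResidual a (suc r) α → IsResidual a r (init α)
residual-init {a} {r} res = record
  { bounded = λ i → bounded (inject₁ i)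
  ; initial = λ i₀ eq i i<i₀ → initial (inject₁ i₀) eq (inject₁ i)
      (subst₂ _<_ (sym (toℕ-inject₁ i)) (sym (toℕ-inject₁ i₀)) i<i₀)
  } where open IsResidual res

-- If the top digit is `a`, all lower digits vanish. Otherwise it is at most `a - 1`, and the lower
-- digits contribute less than `R a (suc r)` by induction. Either way the value is at most
-- `a * R a (suc r)`, one less than the next repunit.
value< : ∀ b {r} (α : Vector ℕ r) → IsResidual (suc b) r α → value (suc b) α < R (suc b) (suc r)
value< b {zero}  α res = s≤s z≤n
value< b {suc r} α res with last α ≟ suc b
... | yes top = begin-strict
    value a α                           ≡⟨ value-init-last a α ⟩
    value a (init α) + last α * R a (suc r)  ≡⟨ cong₂ (λ x y → x + y * R a (suc r)) init-zero top ⟩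
    a * R a (suc r)                     <⟨ ≤-refl ⟩
    1 + a * R a (suc r)                 ≡⟨ R-suc a (suc r) ⟨
    R a (suc (suc r))                   ∎
  where
  open ≤-Reasoning
  open IsResidual res
  a = suc b
  init-zero : value a (init α) ≡ 0
  init-zero = value-zero a (init α) (λ i → initial (fromℕ r) top (inject₁ i)
    (subst₂ _<_ (sym (toℕ-inject₁ i)) (sym (toℕ-fromℕ r)) (toℕ<n i)))
... | no ¬top = begin-strict
    value a α                           ≡⟨ value-init-last a α ⟩
    value a (init α) + last α * R a (suc r)
      <⟨ +-mono-<-≤ (value< b (init α) (residual-init res))
          (*-monoˡ-≤ (R a (suc r)) (s≤s⁻¹ (≤∧≢⇒< (bounded (fromℕ r)) ¬top))) ⟩
    a * R a (suc r)                     <⟨ ≤-refl ⟩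
    1 + a * R a (suc r)                 ≡⟨ R-suc a (suc r) ⟨
    R a (suc (suc r))                   ∎
  where
  open ≤-Reasoning
  open IsResidual res
  a = suc b

residual⇒Rep : ∀ a {r} (α : Vector ℕ r) → Rep a (_≤ r) (sum α) (value a α)
residual⇒Rep a {zero} α = []
residual⇒Rep a {suc r} α = subst₂ (Rep a _) (sym (sum-init-last α)) (sym (value-init-last a α))
  (Rep-+ (Rep-⊆ m≤n⇒m≤1+n (residual⇒Rep a (init α))) (Rep-replicate (last α) ≤-refl))

-- By `Rep-remove-*`, as many summands as the top digit says can be split off any representation. By
-- `value<` the remaining weight is too small for the top index, so induction on the lower digits
-- applies.
residual-minimal : ∀ b {r ℓ} (α : Vector ℕ r) → IsResidual (suc b) r α →
  Rep (suc b) (_≤ r) ℓ (value (suc b) α) → sum α ≤ ℓ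
residual-minimal b {zero} α res ρ = z≤n
residual-minimal b {suc r} {ℓ} α res ρ
  with ℓ′ , refl , σ ← Rep-remove-* r (last α) (subst (Rep (suc b) _ ℓ)
         (trans (value-init-last (suc b) α) (+-comm (value (suc b) (init α)) _)) ρ)
  = begin
    sum α                ≡⟨ sum-init-last α ⟩
    sum (init α) + last α ≤⟨ +-monoˡ-≤ (last α) (residual-minimal b (init α) res′
                               (Rep-restrict (value< b (init α) res′) σ)) ⟩
    ℓ′ + last α          ≡⟨ +-comm ℓ′ (last α) ⟩
    last α + ℓ′          ∎
  where
  open ≤-Reasoning
  res′ = residual-init res

+*-injective : ∀ {D q q′ x x′} → x < D → x′ < D → x + q * D ≡ x′ + q′ * D → x ≡ x′ × q ≡ q′
+*-injective {D} {q} {q′} {x} {x′} x<D x′<D eq = x≡x′ , q≡q′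
  where
  instance _ = >-nonZero (≤-<-trans z≤n x<D)
  x≡x′ : x ≡ x′
  x≡x′ = begin
    x                  ≡⟨ m<n⇒m%n≡m x<D ⟨
    x % D              ≡⟨ [m+kn]%n≡m%n x q D ⟨
    (x + q * D) % D    ≡⟨ cong (_% D) eq ⟩
    (x′ + q′ * D) % D  ≡⟨ [m+kn]%n≡m%n x′ q′ D ⟩
    x′ % D             ≡⟨ m<n⇒m%n≡m x′<D ⟩
    x′                 ∎
    where open ≡-Reasoning
  q≡q′ : q ≡ q′
  q≡q′ = *-cancelʳ-≡ q q′ D (+-cancelˡ-≡ x _ _ (trans eq (cong (_+ q′ * D) (sym x≡x′))))

-- By `value<`, the top digit and the value of the lower digits are quotient and remainder in the
-- division by `R a (suc r)`, hence determined.
residual-unique : ∀ b {r} (α β : Vector ℕ r) → IsResidual (suc b) r α → IsResidual (suc b) r β →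
  value (suc b) α ≡ value (suc b) β → α ≗ β
residual-unique b {suc r} α β res-α res-β eq i with +*-injective {q = last α} {q′ = last β}
    (value< b (init α) (residual-init res-α)) (value< b (init β) (residual-init res-β))
    (trans (sym (value-init-last (suc b) α)) (trans eq (value-init-last (suc b) β))) | view i
... | _ , last≡ | ‵fromℕ         = last≡
... | init≡ , _ | ‵inj₁ {i = j} _ =
  residual-unique b (init α) (init β) (residual-init res-α) (residual-init res-β) init≡ j

insertAt-inject₁ : ∀ {r} (β : Vector ℕ r) q j → insertAt β (fromℕ r) q (inject₁ j) ≡ β j
insertAt-inject₁ β q zero    = refl
insertAt-inject₁ β q (suc j) = insertAt-inject₁ (β ∘ suc) q j

-- Greedy expansion: the top digit is the quotient of `w` by the largest available repunit, the
-- lower digits expand the remainder.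
residual-exists : ∀ b r {w} → w < R (suc b) (suc r) →
  ∃[ α ] (IsResidual (suc b) r α × value (suc b) α ≡ w)
residual-exists b zero w<1 =
  (λ ()) , record { bounded = λ () ; initial = λ () } , sym (n<1⇒n≡0 w<1)
residual-exists b (suc r) {w} w<R
  with β , res , val ← residual-exists b r (m%n<n w (R (suc b) (suc r)))
  = α , record { bounded = bounded ; initial = initial } , val-α
  where
  a D q : ℕ
  a = suc b
  D = R a (suc r)
  q = w / D
  α : Vector ℕ (suc r)
  α = insertAt β (fromℕ r) q
  last-α : last α ≡ q
  last-α = insertAt-lookup β (fromℕ r) q
  w≡ : w ≡ w % D + q * D
  w≡ = m≡m%n+[m/n]*n w D
  rem+qD≤aD : w % D + q * D ≤ a * D
  rem+qD≤aD = s≤s⁻¹ (subst₂ _<_ w≡ (R-suc a (suc r)) w<R)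
  bounded : ∀ i → α i ≤ a
  bounded i with view i
  ... | ‵fromℕ = ≤-trans (≤-reflexive last-α)
                   (*-cancelʳ-≤ q a D (≤-trans (m≤n+m (q * D) (w % D)) rem+qD≤aD))
  ... | ‵inj₁ {i = j} _ = ≤-trans (≤-reflexive (insertAt-inject₁ β q j)) (IsResidual.bounded res j)
  -- As `w` is at most `a * D`, a quotient `a` leaves remainder 0, and digits of value 0 vanish
  -- because all their repunits are positive.
  β-zero : q ≡ a → ∀ j → β j ≡ 0
  β-zero q≡a j = n≤0⇒n≡0 (begin
    β j        ≤⟨ lookup≤sum β j ⟩
    sum β      ≤⟨ sum≤value a β ⟩
    value a β  ≡⟨ val ⟩
    w % D      ≤⟨ +-cancelʳ-≤ (a * D) _ 0 (subst (λ x → w % D + x * D ≤ a * D) q≡a rem+qD≤aD) ⟩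
    0          ∎)
    where open ≤-Reasoning
  initial : ∀ i₀ → α i₀ ≡ a → ∀ i → i Fin.< i₀ → α i ≡ 0
  initial i₀ eq i i<i₀ with view i | view i₀
  ... | ‵fromℕ | _ = contradiction (≤-trans (s≤s (≤-reflexive (sym (toℕ-fromℕ r)))) i<i₀)
                       (<⇒≱ (toℕ<n i₀))
  ... | ‵inj₁ {i = j} _ | ‵fromℕ =
        trans (insertAt-inject₁ β q j) (β-zero (trans (sym last-α) eq) j)
  ... | ‵inj₁ {i = j} _ | ‵inj₁ {i = j₀} _ =
        trans (insertAt-inject₁ β q j) (IsResidual.initial res j₀
          (trans (sym (insertAt-inject₁ β q j₀)) eq) j
          (subst₂ _<_ (toℕ-inject₁ j) (toℕ-inject₁ j₀) i<i₀))
  val-α : value a α ≡ w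
  val-α = begin
    value a α                      ≡⟨ value-init-last a α ⟩
    value a (init α) + last α * D  ≡⟨ cong₂ (λ x y → x + y * D)
      (sum-cong-≗ (λ j → cong (_* R a (suc (toℕ j))) (insertAt-inject₁ β q j))) last-α ⟩
    value a β + q * D              ≡⟨ cong (_+ q * D) val ⟩
    w % D + q * D                  ≡⟨ w≡ ⟨
    w                              ∎
    where
    open ≡-Reasoning

-- Solving `y ≡ K w` modulo `N`

coprime-residue : ∀ {N K} .{{_ : NonZero N}} → Coprime N K → ∀ y →
  ∃[ w ] (w < N × ∃₂ λ u v → y + N * u ≡ K * w + N * v)
coprime-residue {N@(suc p)} {K} coprime y = reduce (unreduced (coprime-Bézout coprime))
  where
  unreduced : Bézout.Identity 1 N K → ∃[ w ] ∃₂ λ u v → y + N * u ≡ K * w + N * v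
  -- Here `-t` inverts `K` modulo `N`; the factor `p = N - 1` stands in for `-1`.
  unreduced (Bézout.+- s t eq) = y * t * p , y * t * K , y * s , (begin
    y + N * (y * t * K)                  ≡⟨ lemma₁ y t K p ⟩
    y * (1 + t * K) + K * (y * t * p)    ≡⟨ cong (λ x → y * x + K * (y * t * p)) eq ⟩
    y * (s * N) + K * (y * t * p)        ≡⟨ lemma₂ y s p (K * (y * t * p)) ⟩
    K * (y * t * p) + N * (y * s)        ∎)
    where
    open ≡-Reasoning
    lemma₁ : ∀ y t K p → y + suc p * (y * t * K) ≡ y * (1 + t * K) + K * (y * t * p)
    lemma₁ = solve-∀
    lemma₂ : ∀ y s p x → y * (s * suc p) + x ≡ x + suc p * (y * s)
    lemma₂ = solve-∀
  unreduced (Bézout.-+ s t eq) = y * t , y * s , 0 , (begin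
    y + N * (y * s)        ≡⟨ lemma₁ y s p ⟩
    y * (1 + s * N)        ≡⟨ cong (y *_) eq ⟩
    y * (t * K)            ≡⟨ lemma₂ y t K p ⟩
    K * (y * t) + N * 0    ∎)
    where
    open ≡-Reasoning
    lemma₁ : ∀ y s p → y + suc p * (y * s) ≡ y * (1 + s * suc p)
    lemma₁ = solve-∀
    lemma₂ : ∀ y t K p → y * (t * K) ≡ K * (y * t) + suc p * 0
    lemma₂ = solve-∀
  reduce : (∃[ w ] ∃₂ λ u v → y + N * u ≡ K * w + N * v) →
    ∃[ w ] (w < N × ∃₂ λ u v → y + N * u ≡ K * w + N * v)
  reduce (w , u , v , eq) = w % N , m%n<n w N , u , K * (w / N) + v , (begin
    y + N * u                                  ≡⟨ eq ⟩
    K * w + N * v                              ≡⟨ cong (λ x → K * x + N * v) (m≡m%n+[m/n]*n w N) ⟩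
    K * (w % N + w / N * N) + N * v            ≡⟨ lemma K (w % N) (w / N) N v ⟩
    K * (w % N) + N * (K * (w / N) + v)        ∎)
    where
    open ≡-Reasoning
    lemma : ∀ K r q N v → K * (r + q * N) + N * v ≡ K * r + N * (K * q + v)
    lemma = solve-∀

-- In Reduced, N, K and T stand for s_0/λ, (a-1) c aⁿ/λ and (1/λ) S_n.

module Reduced (b N K : ℕ) .{{_ : NonZero N}}
               (coprime : Coprime N K) (N<K : N < K) (bN≤K : b * N ≤ K) where

  private a = suc b

  T : Pred ℕ 0ℓ
  T y = ∃₂ λ ℓ w → Rep a U ℓ w × y ≡ N * ℓ + K * w

  -- Cancelling `K * w` leaves `N ∣ K * e`, and `N` is coprime to `K`.
  weights-≡-mod : ∀ {x x′ w e} → N * x + K * w ≡ N * x′ + K * (w + e) → N ∣ e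
  weights-≡-mod {x} {x′} {w} {e} eq = coprime-divisor coprime (∣m+n∣m⇒∣n
    (subst (N ∣_) (+-cancelʳ-≡ (K * w) _ _ (trans eq (lemma N x′ K w e))) (m∣m*n x))
    (m∣m*n x′))
    where
    lemma : ∀ N x K w e → N * x + K * (w + e) ≡ N * x + K * e + K * w
    lemma = solve-∀

  -- With two or more summands, a weight `w ≥ v` makes the left side too large, while `w < v` would
  -- make `N` divide the positive number `v - w < N`.
  length≤1 : ∀ {ℓ w v} → v < N → N * ℓ + K * w ≡ N * 1 + K * v → ℓ ≤ 1
  length≤1 {ℓ} {w} {v} v<N eq = ≮⇒≥ (λ 1<ℓ → case <-≤-connex w v of λ where
    (inj₂ v≤w) → <⇒≢ (+-mono-<-≤ (*-monoʳ-< N 1<ℓ) (*-monoʳ-≤ K v≤w)) (sym eq)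
    (inj₁ w<v) → contradiction
      (∣⇒≤ {{>-nonZero (m<n⇒0<n∸m w<v)}} (weights-≡-mod {x = ℓ} {x′ = 1} {w = w}
        (trans eq (cong (λ x → N * 1 + K * x) (sym (m+[n∸m]≡n (<⇒≤ w<v)))))))
      (<⇒≱ (≤-<-trans (m∸n≤m v w) v<N)))

  -- Two nonempty representations have at least two summands together, which `length≤1` excludes.
  T-irreducible : ∀ {j y z} → R a j < N → y ∈ T → z ∈ T → N + K * R a j ≡ y + z → y ≡ 0 ⊎ z ≡ 0
  T-irreducible _ (_ , _ , [] , refl) _ _ =
    inj₁ (cong₂ _+_ (*-zeroʳ N) (*-zeroʳ K))
  T-irreducible _ _ (_ , _ , [] , refl) _ =
    inj₂ (cong₂ _+_ (*-zeroʳ N) (*-zeroʳ K))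
  T-irreducible {j} Rj<N (suc ℓ , w , _ ∷ _ , refl) (suc ℓ′ , w′ , _ ∷ _ , refl) eq =
    contradiction (length≤1 {suc ℓ + suc ℓ′} {w + w′} Rj<N
      (trans (lemma N (suc ℓ) (suc ℓ′) K w w′) (trans (sym eq) (cong (_+ K * R a j) (sym (*-identityʳ N))))))
      (<⇒≱ (s≤s (≤-trans (s≤s z≤n) (m≤n+m (suc ℓ′) ℓ))))
    where
    lemma : ∀ N ℓ ℓ′ K w w′ → N * (ℓ + ℓ′) + K * (w + w′) ≡ N * ℓ + K * w + (N * ℓ′ + K * w′)
    lemma = solve-∀

  module _ {r} (α : Vector ℕ r) (res : IsResidual a r α) (N≡ : N ≡ 1 + value a α) where

    private
      -- `p` is `N - 1`, `L` is the least number of repunits with sum `p`, and `Y` turns out to be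
      -- the largest Apéry element of `T` with respect to `N`.
      p L Y : ℕ
      p = value a α
      L = sum α
      Y = N * L + K * p

      p<N : p < N
      p<N = ≤-reflexive (sym N≡)

    residual-weight∈T : Y ∈ T
    residual-weight∈T = L , p , Rep-⊆ _ (residual⇒Rep a α) , refl

    -- Each decrement of w costs at most b summands, i.e. b * N, and gains K.
    weight< : ∀ {w} → w < N → ∃[ ℓ ] (Rep a U ℓ w × N * ℓ + K * w ≤ Y)
    weight< {w} w<N = e * b + L
      , Rep-⊆ _ (Rep-decrement-* e (subst (Rep a _ L) (sym e+w≡p) (residual⇒Rep a α)))
      , (begin
        N * (e * b + L) + K * w    ≡⟨ lemma N e b L (K * w) ⟩
        N * L + (e * (b * N) + K * w)  ≤⟨ +-monoʳ-≤ (N * L) (+-monoˡ-≤ (K * w) (*-monoʳ-≤ e bN≤K)) ⟩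
        N * L + (e * K + K * w)    ≡⟨ cong (_+_ (N * L)) (lemma′ e K w) ⟩
        N * L + K * (e + w)        ≡⟨ cong (λ x → N * L + K * x) e+w≡p ⟩
        Y                          ∎)
      where
      open ≤-Reasoning
      e = p ∸ w
      e+w≡p : e + w ≡ p
      e+w≡p = m∸n+n≡m (s≤s⁻¹ (subst (w <_) N≡ w<N))
      lemma : ∀ N e b L x → N * (e * b + L) + x ≡ N * L + (e * (b * N) + x)
      lemma = solve-∀
      lemma′ : ∀ e K w → e * K + K * w ≡ K * (e + w)
      lemma′ = solve-∀

    -- The class of `y` modulo `N` contains an element `N ℓ + K w` of `T` with `w < N`, at most `Y`
    -- by `weight<`. If `y` were not below it, padding with copies of `N` would put `y` into `T`; so
    -- `y` lies at least `N` below it.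
    ∉T⇒≤ : ∀ {y} → y ∉ T → y + N ≤ Y
    ∉T⇒≤ {y} y∉T with w , w<N , u , v , eq ← coprime-residue coprime y
      with ℓ , ρ , Y′≤Y ← weight< w<N = case ≤-<-connex (u + ℓ) v of λ where
        (inj₁ u+ℓ≤v) → contradiction
          ((v ∸ (u + ℓ)) + ℓ , w , Rep-pad (v ∸ (u + ℓ)) tt ρ , +-cancelˡ-≡ (N * u) _ _ (begin-equality
            N * u + y                                    ≡⟨ +-comm (N * u) y ⟩
            y + N * u                                    ≡⟨ eq ⟩
            K * w + N * v                                ≡⟨ cong (λ x → K * w + N * x) (m∸n+n≡m u+ℓ≤v) ⟨
            K * w + N * (v ∸ (u + ℓ) + (u + ℓ))          ≡⟨ lemma₁ (K * w) N (v ∸ (u + ℓ)) u ℓ ⟩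
            N * u + (N * (v ∸ (u + ℓ) + ℓ) + K * w)      ∎))
          y∉T
        (inj₂ v<u+ℓ) → ≤-trans (+-cancelʳ-≤ (N * v) _ _ (begin
          y + N + N * v            ≡⟨ lemma₂ y N v ⟩
          y + N * suc v            ≤⟨ +-monoʳ-≤ y (*-monoʳ-≤ N v<u+ℓ) ⟩
          y + N * (u + ℓ)          ≡⟨ lemma₃ y N u ℓ ⟩
          N * ℓ + (y + N * u)      ≡⟨ cong (_+_ (N * ℓ)) eq ⟩
          N * ℓ + (K * w + N * v)  ≡⟨ +-assoc (N * ℓ) _ _ ⟨
          N * ℓ + K * w + N * v    ∎)) Y′≤Y
      where
      open ≤-Reasoning
      lemma₁ : ∀ x N e u ℓ → x + N * (e + (u + ℓ)) ≡ N * u + (N * (e + ℓ) + x)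
      lemma₁ = solve-∀
      lemma₂ : ∀ y N v → y + N + N * v ≡ y + N * suc v
      lemma₂ = solve-∀
      lemma₃ : ∀ y N u ℓ → y + N * (u + ℓ) ≡ N * ℓ + (y + N * u)
      lemma₃ = solve-∀

    -- A representation of `Y - N` yields one of `Y` with `suc ℓ` summands and weight `w ≡ p` modulo
    -- `N`. If `w > p`, then `w ≥ p + N` costs an extra `N K`, more than `N L` since `L < N < K`. If
    -- `w ≤ p`, then `w = p` and `L = suc ℓ`, against the minimality of `L`.
    ∸N∉T : ∀ {y} → y + N ≡ Y → y ∉ T
    ∸N∉T eq (ℓ , w , ρ , refl) = case <-≤-connex p w of λ where
        (inj₁ p<w) →
          let N≤e = ∣⇒≤ {{>-nonZero (m<n⇒0<n∸m p<w)}} (weights-≡-mod {x = L} {x′ = suc ℓ} {w = p}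
                      (trans (sym eq′) (cong (λ x → N * suc ℓ + K * x) (sym (m+[n∸m]≡n (<⇒≤ p<w))))))
          in <⇒≱ (*-monoʳ-< N (<-trans L<N N<K)) (+-cancelʳ-≤ (K * p) _ _ (begin
            N * K + K * p                  ≡⟨ lemma₂ N K p ⟩
            K * (p + N)                    ≤⟨ *-monoʳ-≤ K (+-monoʳ-≤ p N≤e) ⟩
            K * (p + (w ∸ p))              ≡⟨ cong (K *_) (m+[n∸m]≡n (<⇒≤ p<w)) ⟩
            K * w                          ≤⟨ m≤n+m (K * w) (N * suc ℓ) ⟩
            N * suc ℓ + K * w              ≡⟨ eq′ ⟩
            N * L + K * p                  ∎))
        (inj₂ w≤p) →
          let N∣e = weights-≡-mod {x = suc ℓ} {x′ = L} {w = w}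
                      (trans eq′ (cong (λ x → N * L + K * x) (sym (m+[n∸m]≡n w≤p))))
              w≡p = ≤-antisym w≤p (m∸n≡0⇒m≤n (∣-<⇒≡0 N∣e (≤-<-trans (m∸n≤m p w) p<N)))
              1+ℓ≡L = *-cancelˡ-≡ (suc ℓ) L N (+-cancelʳ-≡ (K * p) _ _
                        (trans (cong (λ x → N * suc ℓ + K * x) (sym w≡p)) eq′))
          in contradiction
            (residual-minimal b α res (Rep-restrict (value< b α res) (subst (Rep a U ℓ) w≡p ρ)))
            (<⇒≱ (≤-reflexive 1+ℓ≡L))
      where
      open ≤-Reasoning
      lemma₁ : ∀ N ℓ x → N * suc ℓ + x ≡ N * ℓ + x + N
      lemma₁ = solve-∀
      lemma₂ : ∀ N K p → N * K + K * p ≡ K * (p + N)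
      lemma₂ = solve-∀
      L<N : L < N
      L<N = ≤-<-trans (sum≤value a α) p<N
      eq′ : N * suc ℓ + K * w ≡ N * L + K * p
      eq′ = trans (lemma₁ N ℓ (K * w)) eq
      ∣-<⇒≡0 : ∀ {e} → N ∣ e → e < N → e ≡ 0
      ∣-<⇒≡0 {zero}  _   _   = refl
      ∣-<⇒≡0 {suc e} N∣e e<N = contradiction e<N (≤⇒≯ (∣⇒≤ N∣e))

-- Submonoids of ℕ

⟨⟩-least : ∀ {A B} → A ⊆ ⟨ B ⟩ → ⟨ A ⟩ ⊆ ⟨ B ⟩
⟨⟩-least A⊆⟨B⟩ (gen p) = A⊆⟨B⟩ p
⟨⟩-least A⊆⟨B⟩ ε       = ε
⟨⟩-least A⊆⟨B⟩ (p ⊕ q) = ⟨⟩-least A⊆⟨B⟩ p ⊕ ⟨⟩-least A⊆⟨B⟩ q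

⟨⟩-* : ∀ {A x} k → x ∈ ⟨ A ⟩ → k * x ∈ ⟨ A ⟩
⟨⟩-* zero    p = ε
⟨⟩-* (suc k) p = p ⊕ ⟨⟩-* k p

⟨⟩-∣ : ∀ {A k} → (∀ {x} → x ∈ A → k ∣ x) → ∀ {x} → x ∈ ⟨ A ⟩ → k ∣ x
⟨⟩-∣ k∣A (gen p) = k∣A p
⟨⟩-∣ k∣A ε       = _ ∣0
⟨⟩-∣ k∣A (p ⊕ q) = ∣m∣n⇒∣m+n (⟨⟩-∣ k∣A p) (⟨⟩-∣ k∣A q)

-- Induction on the derivation: in a sum one part is 0 and the other is the element itself.
irreducible⇒generator : ∀ {A x} → x ∈ ⟨ A ⟩ → x ≢ 0 →
  (∀ {y z} → y ∈ ⟨ A ⟩ → z ∈ ⟨ A ⟩ → x ≡ y + z → y ≡ 0 ⊎ z ≡ 0) → x ∈ A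
irreducible⇒generator (gen p) _ _ = p
irreducible⇒generator ε x≢0 _ = contradiction refl x≢0
irreducible⇒generator {A} (_⊕_ {y} {z} p q) x≢0 irr with irr p q refl
... | inj₁ refl = irreducible⇒generator q x≢0 irr
... | inj₂ refl = subst A (sym y+0≡y) (irreducible⇒generator p (x≢0 ∘ trans y+0≡y)
        (λ p′ q′ eq → irr p′ q′ (trans y+0≡y eq)))
  where y+0≡y = +-identityʳ y

length≤1-singleton : ∀ {x} (xs : List ℕ) → Unique xs → (∀ {y} → y ∈ˡ xs → y ≡ x) → length xs ≤ 1
length≤1-singleton List.[] _ _ = z≤n
length≤1-singleton (_ List.∷ List.[]) _ _ = s≤s z≤n
length≤1-singleton (y List.∷ z List.∷ _) ((y≢z ∷ _) ∷ _) ⊆x =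
  contradiction (trans (⊆x (here refl)) (sym (⊆x (there (here refl))))) y≢z

sum-affine : ∀ N K {r} (α f : Vector ℕ r) →
  ∑[ j < r ] (α j * (N + K * f j)) ≡ N * sum α + K * ∑[ j < r ] (α j * f j)
sum-affine N K {zero}  α f = sym (cong₂ _+_ (*-zeroʳ N) (*-zeroʳ K))
sum-affine N K {suc r} α f = trans
  (cong (_+_ (α zero * (N + K * f zero))) (sum-affine N K (α ∘ suc) (f ∘ suc)))
  (lemma (α zero) N K (f zero) _ _)
  where
  lemma : ∀ x N K y s t → x * (N + K * y) + (N * s + K * t) ≡ N * (x + s) + K * (x * y + t)
  lemma = solve-∀

-- Dividing `S` by its greatest common divisor `g`

module Scaled (b c d n : ℕ) (1≤b : 1 ≤ b) (d<ca : d < c * suc b) (1≤n : 1 ≤ n) (0<d : 0 < d)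
              (g : ℕ) .{{_ : NonZero g}} (isGCD : IsGCD (S (suc b) c d n) g) where

  private
    a q s₀ N K : ℕ
    a  = suc b
    q  = c * a ^ n
    s₀ = s a c d n 0
    N  = s₀ / g
    K  = b * q / g

  open IsGCD isGCD

  d<q : d < q
  d<q = <-≤-trans d<ca (*-monoʳ-≤ c (≤-trans (≤-reflexive (sym (*-identityʳ a))) (^-monoʳ-≤ a 1≤n)))

  s₀≡q∸d : s₀ ≡ q ∸ d
  s₀≡q∸d = cong (λ k → c * a ^ k ∸ d) (+-identityʳ n)

  s-affine : ∀ j → s a c d n j ≡ s₀ + b * q * R a j
  s-affine j = begin
    c * a ^ (n + j) ∸ d            ≡⟨ cong (λ x → c * x ∸ d) (^-distribˡ-+-* a n j) ⟩
    c * (a ^ n * a ^ j) ∸ d        ≡⟨ cong (λ x → c * (a ^ n * x) ∸ d) (^≡1+R b j) ⟩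
    c * (a ^ n * (1 + b * R a j)) ∸ d  ≡⟨ cong (_∸ d) (lemma c (a ^ n) b (R a j)) ⟩
    (q + b * q * R a j) ∸ d        ≡⟨ +-∸-comm (b * q * R a j) (<⇒≤ d<q) ⟩
    (q ∸ d) + b * q * R a j        ≡⟨ cong (_+ b * q * R a j) s₀≡q∸d ⟨
    s₀ + b * q * R a j             ∎
    where
    open ≡-Reasoning
    lemma : ∀ c x b y → c * (x * (1 + b * y)) ≡ c * x + b * (c * x) * y
    lemma = solve-∀

  s∈S : ∀ j → s a c d n j ∈ S a c d n
  s∈S j = gen (j , refl)

  g∣s₀ : g ∣ s₀
  g∣s₀ = commonDivisor (s∈S 0)

  s₀≡Ng : s₀ ≡ N * g
  s₀≡Ng = sym (m/n*n≡m g∣s₀)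

  -- `b * q` is the difference of `s_1` and `s_0`, both divisible by `g`, so the division defining
  -- `K` is exact.
  bq≡Kg : b * q ≡ K * g
  bq≡Kg = sym (m/n*n≡m (∣m+n∣m⇒∣n
    (subst (g ∣_) (trans (s-affine 1) (cong (_+_ s₀) (*-identityʳ (b * q)))) (commonDivisor (s∈S 1)))
    g∣s₀))

  s-scaled : ∀ j → s a c d n j ≡ (N + K * R a j) * g
  s-scaled j = begin
    s a c d n j              ≡⟨ s-affine j ⟩
    s₀ + b * q * R a j       ≡⟨ cong₂ (λ x y → x + y * R a j) s₀≡Ng bq≡Kg ⟩
    N * g + K * g * R a j    ≡⟨ lemma N K (R a j) g ⟩
    (N + K * R a j) * g      ∎
    where
    open ≡-Reasoning
    lemma : ∀ N K x g → N * g + K * g * x ≡ (N + K * x) * g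
    lemma = solve-∀

  instance
    N-nonZero : NonZero N
    N-nonZero = ≢-nonZero (λ N≡0 → <⇒≢ (m<n⇒0<n∸m d<q)
      (sym (trans (sym s₀≡q∸d) (trans s₀≡Ng (cong (_* g) N≡0)))))

  -- If `e` divides `N` and `K`, then `e * g` divides every generator, hence the greatest common
  -- divisor `g`.
  coprime : Coprime N K
  coprime {e} (e∣N , e∣K) = ∣1⇒≡1 (*-cancelʳ-∣ g (subst (e * g ∣_) (sym (*-identityˡ g))
    (greatest (⟨⟩-∣ λ { (j , refl) → subst (e * g ∣_) (sym (s-scaled j))
      (*-monoˡ-∣ g (∣m∣n⇒∣m+n e∣N (∣m⇒∣m*n (R a j) e∣K))) }))))

  -- Strict because `d > 0`: `q - d < q ≤ b * q`.
  N<K : N < K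
  N<K = *-cancelʳ-< g N K (begin-strict
    N * g   ≡⟨ s₀≡Ng ⟨
    s₀      ≡⟨ s₀≡q∸d ⟩
    q ∸ d   <⟨ ∸-monoʳ-< 0<d (<⇒≤ d<q) ⟩
    q       ≤⟨ m≤n*m q b {{>-nonZero 1≤b}} ⟩
    b * q   ≡⟨ bq≡Kg ⟩
    K * g   ∎)
    where open ≤-Reasoning

  bN≤K : b * N ≤ K
  bN≤K = *-cancelʳ-≤ (b * N) K g (begin
    b * N * g    ≡⟨ *-assoc b N g ⟩
    b * (N * g)  ≡⟨ cong (b *_) s₀≡Ng ⟨
    b * s₀       ≡⟨ cong (b *_) s₀≡q∸d ⟩
    b * (q ∸ d)  ≤⟨ *-monoʳ-≤ b (m∸n≤m q d) ⟩
    b * q        ≡⟨ bq≡Kg ⟩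
    K * g        ∎)
    where open ≤-Reasoning

  open Reduced b N K coprime N<K bN≤K public

  -- Together with `S⇒T` this identifies `S` with the multiples by `g` of the elements of `T`.
  T⇒S : ∀ {y} → y ∈ T → y * g ∈ S a c d n
  T⇒S (_ , _ , ρ , refl) = go ρ
    where
    lemma : ∀ N K ℓ x w g → (N + K * x) * g + (N * ℓ + K * w) * g ≡ (N * suc ℓ + K * (x + w)) * g
    lemma = solve-∀
    go : ∀ {ℓ w} → Rep a U ℓ w → (N * ℓ + K * w) * g ∈ S a c d n
    go [] = subst (S a c d n) (sym (cong₂ (λ x y → (x + y) * g) (*-zeroʳ N) (*-zeroʳ K))) ε
    go (_∷_ {j} {ℓ} {w} _ ρ) = subst (S a c d n)
      (trans (cong (_+ (N * ℓ + K * w) * g) (s-scaled j)) (lemma N K ℓ (R a j) w g))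
      (s∈S j ⊕ go ρ)

  S⇒T : ∀ {x} → x ∈ S a c d n → ∃[ y ] (y ∈ T × x ≡ y * g)
  S⇒T (gen (j , refl)) = N + K * R a j , (1 , R a j + 0 , (_∷_ {j = j} _ [] ,
    cong₂ (λ x y → x + K * y) (sym (*-identityʳ N)) (sym (+-identityʳ (R a j))))) , s-scaled j
  S⇒T ε = 0 , (0 , 0 , [] , sym (cong₂ _+_ (*-zeroʳ N) (*-zeroʳ K))) , refl
  S⇒T (p ⊕ q) with _ , (ℓ , w , ρ , refl) , refl ← S⇒T p | _ , (ℓ′ , w′ , σ , refl) , refl ← S⇒T q =
    _ , (ℓ + ℓ′ , w + w′ , Rep-+ ρ σ , refl) , lemma N K ℓ ℓ′ w w′ g
    where
    lemma : ∀ N K ℓ ℓ′ w w′ g → (N * ℓ + K * w) * g + (N * ℓ′ + K * w′) * g ≡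
      (N * (ℓ + ℓ′) + K * (w + w′)) * g
    lemma = solve-∀

  s-irreducible : ∀ {j y z} → R a j < N → y ∈ S a c d n → z ∈ S a c d n →
    s a c d n j ≡ y + z → y ≡ 0 ⊎ z ≡ 0
  s-irreducible {j} Rj<N p q eq
    with y , y∈T , refl ← S⇒T p | z , z∈T , refl ← S⇒T q
    with T-irreducible {j} Rj<N y∈T z∈T
      (*-cancelʳ-≡ _ _ g (trans (sym (s-scaled j)) (trans eq (sym (*-distribʳ-+ g y z)))))
  ... | inj₁ y≡0 = inj₁ (cong (_* g) y≡0)
  ... | inj₂ z≡0 = inj₂ (cong (_* g) z≡0)

  s≢0 : ∀ j → s a c d n j ≢ 0
  s≢0 j eq = ≢-nonZero⁻¹ N (m+n≡0⇒m≡0 N (m*n≡0⇒m≡0 (N + K * R a j) g (trans (sym (s-scaled j)) eq)))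

  s-mono-< : ∀ {i j} → i < j → s a c d n i < s a c d n j
  s-mono-< {i} {j} i<j = subst₂ _<_ (sym (s-scaled i)) (sym (s-scaled j))
    (*-monoˡ-< g (+-monoʳ-< N (*-monoʳ-< K {{>-nonZero (≤-<-trans z≤n N<K)}} (R-mono-< b i<j))))

  -- If `R_m < N`, the `m + 1` distinct numbers `s_0, ..., s_m` would be irreducible, hence all
  -- members of a generating list of length `m`.
  N≤R : ∀ {m} → HasEmbeddingDimension (S a c d n) m → N ≤ R a m
  N≤R {m} (xs , _ , refl , (⊆S , S⊆) , _) = ≮⇒≥ λ Rm<N →
    let s∈xs : ∀ (i : Fin (suc m)) → s a c d n (toℕ i) ∈ˡ xs
        s∈xs i = irreducible⇒generator (S⊆ (s∈S (toℕ i))) (s≢0 (toℕ i))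
          (λ p q → s-irreducible {toℕ i} (≤-<-trans (R-mono-≤ b (toℕ≤pred[n] i)) Rm<N) (⊆S p) (⊆S q))
        i , j , i<j , eq = pigeonhole (n<1+n m) (index ∘ s∈xs)
    in <⇒≢ (s-mono-< i<j) (trans (lookup-index (s∈xs i))
         (trans (cong (lookup xs) eq) (sym (lookup-index (s∈xs j)))))

  -- If `N = 1`, then `s_0 = g` divides every element, so `s_0` alone generates `S` and the minimal
  -- generating set has at most one element.
  1<N : ∀ {m} → HasEmbeddingDimension (S a c d n) m → 2 ≤ m → 1 < N
  1<N {m} (xs , unique , refl , _ , minimal) 2≤m = ≰⇒> λ N≤1 →
    let s₀≡g : s₀ ≡ g
        s₀≡g = trans s₀≡Ng (trans (cong (_* g) (≤-antisym N≤1 (>-nonZero⁻¹ N))) (*-identityˡ g))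
        S⊆⟨s₀⟩ : S a c d n ⊆ ⟨ _≡ s₀ ⟩
        S⊆⟨s₀⟩ p = let divides k x≡kg = commonDivisor p in
          subst ⟨ _≡ s₀ ⟩ (sym (trans x≡kg (cong (k *_) (sym s₀≡g)))) (⟨⟩-* k (gen refl))
    in <⇒≱ 2≤m (length≤1-singleton xs unique
         (minimal (_≡ s₀) (⟨⟩-least (λ { refl → s∈S 0 }) , S⊆⟨s₀⟩)))

  module _ {r} (α : Vector ℕ r) (res : IsResidual a r α) (N≡ : N ≡ 1 + value a α) (1<N′ : 1 < N) where

    private
      Y : ℕ
      Y = N * sum α + K * value a α

    Y∈T : Y ∈ T
    Y∈T = residual-weight∈T α res N≡

    -- As `N > 1`, the value of `α` is positive and `Y` is at least `K`. This keeps the subtraction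
    -- in `Y ∸ N` from being truncated.
    N≤Y : N ≤ Y
    N≤Y = begin
      N              ≤⟨ <⇒≤ N<K ⟩
      K              ≤⟨ m≤m*n K (value a α) {{>-nonZero (s≤s⁻¹ (subst (1 <_) N≡ 1<N′))}} ⟩
      K * value a α  ≤⟨ m≤n+m _ (N * sum α) ⟩
      Y              ∎
      where open ≤-Reasoning

    sum-s/g : ∑[ j < r ] (α j * (s a c d n (suc (toℕ j)) / g)) ≡ Y
    sum-s/g = trans
      (sum-cong-≗ (λ j → cong (α j *_) (trans (cong (_/ g) (s-scaled (suc (toℕ j)))) (m*n/n≡m _ g))))
      (sum-affine N K α (λ j → R a (suc (toℕ j))))

    sum-s : ∑[ j < r ] (α j * s a c d n (suc (toℕ j))) ≡ Y * g
    sum-s = begin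
      ∑[ j < r ] (α j * s a c d n (suc (toℕ j)))
        ≡⟨ sum-cong-≗ (λ j → trans (cong (α j *_) (s-scaled (suc (toℕ j)))) (sym (*-assoc (α j) _ g))) ⟩
      ∑[ j < r ] (α j * (N + K * R a (suc (toℕ j))) * g)
        ≡⟨ *-distribʳ-sum g (λ j → α j * (N + K * R a (suc (toℕ j)))) ⟨
      ∑[ j < r ] (α j * (N + K * R a (suc (toℕ j)))) * g
        ≡⟨ cong (_* g) (sum-affine N K α (λ j → R a (suc (toℕ j)))) ⟩
      Y * g ∎
      where open ≡-Reasoning

    max-Ap : IsMaximum (Ap (S a c d n) s₀) (∑[ j < r ] (α j * s a c d n (suc (toℕ j))))
    max-Ap = subst (IsMaximum (Ap (S a c d n) s₀)) (sym sum-s)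
      ((T⇒S Y∈T , not-shifted) , maximal)
      where
      s₀≤ : ∀ {y} → N ≤ y → s₀ ≤ y * g
      s₀≤ N≤y = ≤-trans (≤-reflexive s₀≡Ng) (*-monoˡ-≤ g N≤y)
      ⊖-scaled : ∀ {y} → N ≤ y → (y * g) ⊖ s₀ ≡ + ((y ∸ N) * g)
      ⊖-scaled {y} N≤y = trans (⊖-≥ (s₀≤ N≤y))
        (cong +_ (trans (cong (y * g ∸_) s₀≡Ng) (sym (*-distribʳ-∸ g y N))))
      not-shifted : ¬ (∃[ z ] (z ∈ S a c d n × + z ≡ (Y * g) ⊖ s₀))
      not-shifted (z , z∈S , eq) with y , y∈T , refl ← S⇒T z∈S =
        ∸N∉T α res N≡
          (trans (cong (_+ N) (*-cancelʳ-≡ y (Y ∸ N) g (+-injective (trans eq (⊖-scaled N≤Y)))))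
            (m∸n+n≡m N≤Y))
          y∈T
      maximal : ∀ {x} → x ∈ Ap (S a c d n) s₀ → x ≤ Y * g
      maximal (x∈S , x∸s₀∉S) with y , y∈T , refl ← S⇒T x∈S with ≤-<-connex N y
      -- Elements below `s_0` have a negative difference and belong to the Apéry set in any case;
      -- they are bounded through `N ≤ Y`.
      ... | inj₂ y<N = *-monoˡ-≤ g (≤-trans (<⇒≤ y<N) N≤Y)
      ... | inj₁ N≤y = *-monoˡ-≤ g (subst (_≤ Y) (m∸n+n≡m N≤y)
              (∉T⇒≤ α res N≡ (λ t → x∸s₀∉S (_ , T⇒S t , sym (⊖-scaled N≤y)))))

    -- The usual relation: the Frobenius number is the largest Apéry element with respect to `N`,
    -- minus `N`.
    frobenius : IsFrobeniusNumber ([1/ g ] S a c d n) (Y ∸ N)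
    frobenius = Y∸N∉ , λ y∉ → m+n≤o⇒m≤o∸n _ (∉T⇒≤ α res N≡
        (λ t → y∉ (_ , T⇒S t , sym (m*n/n≡m _ g))))
      where
      Y∸N∉ : Y ∸ N ∉ [1/ g ] S a c d n
      Y∸N∉ (x , x∈S , eq) with y , y∈T , refl ← S⇒T x∈S =
        ∸N∉T α res N≡ (m∸n+n≡m N≤Y) (subst T (sym (trans eq (m*n/n≡m y g))) y∈T)

corollary5p1 : ∀ (a c d n : ℕ) → 2 ≤ a → 0 < c → d < c * a →
    gcd d a ≡ 1 → gcd d c ≡ 1 → 1 ≤ n → 0 < d →
    ∀ (m : ℕ) → HasEmbeddingDimension (S a c d n) m → 2 ≤ m →
    ∀ (g : ℕ) .{{_ : NonZero g}} → IsGCD (S a c d n) g →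
    ∃! _≗_ (IsResidualExpansion a c d n m g) ×
    (∀ (α : Vector ℕ (m ∸ 1)) → IsResidualExpansion a c d n m g α →
    IsMaximum (Ap (S a c d n) (s a c d n 0))
    (∑[ j < m ∸ 1 ] (α j * s a c d n (suc (toℕ j))))
    ×
    (∃[ f ] (IsFrobeniusNumber ([1/ g ] S a c d n) f ×
    + f ≡ (∑[ j < m ∸ 1 ] (α j * (s a c d n (suc (toℕ j)) / g))) ⊖ (s a c d n 0 / g))))
corollary5p1 (suc b) c d n (s≤s 1≤b) _ d<ca _ _ 1≤n 0<d (suc r) dim 2≤m g isGCD =
  expansion , λ β (res , N≡) →
    max-Ap β res N≡ 2≤N ,
    _ , frobenius β res N≡ 2≤N ,
    sym (trans (cong (_⊖ N) (sum-s/g β res N≡ 2≤N)) (⊖-≥ (N≤Y β res N≡ 2≤N)))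
  where
  open Scaled b c d n 1≤b d<ca 1≤n 0<d g isGCD
  N : ℕ
  N = s (suc b) c d n 0 / g
  2≤N : 2 ≤ N
  2≤N = 1<N dim 2≤m
  expansion : ∃! _≗_ (IsResidualExpansion (suc b) c d n (suc r) g)
  -- The digits expand `N - 1`, which is below `R_m` because `N ≤ R_m`.
  expansion with α , res , eq ← residual-exists b r {pred N}
                   (≤-trans (≤-reflexive (suc-pred N)) (N≤R dim)) =
    α , (res , N≡) , λ {β} (res′ , N≡′) →
      residual-unique b α β res res′ (suc-injective (trans (sym N≡) N≡′))
    where
    N≡ : N ≡ 1 + value (suc b) α
    N≡ = trans (sym (suc-pred N)) (cong suc (sym eq))
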